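{- Any deterministic oracle-model data structure for leaf-to-ancestor minimum queries that makes zero oracle calls at query time requires $\Omega(n\log h)$ oracle comparisons during preprocessing in the worst case over trees with at most $n$ nodes and height at most $h$, where $2\le h\le n$. Precisely: there exist absolute constants $c>0$ and $n_0$ such that for all integers $n\ge n_0$ and $2\le h\le n$, and for every deterministic data structure that correctly answers all leaf-to-ancestor minimum queries on every edge-valued rooted tree with at most $n$ nodes and height at most $h$ using no oracle calls during queries, there exist a rooted tree with at most $n$ nodes and height at most $h$ and an assignment of hidden edge values for which the preprocessing makes at least $c\,n\log h$ oracle calls.
   Context: Problem. The input is a rooted tree $T$ (known explicitly to the algorithm) in which each edge $e$ has a hidden value $w(e)$, a real number. The values are accessible only through a black-box function $\mathrm{Oracle}(e,f)$, which takes two edge identifiers and returns true if and only if $w(e)<w(f)$. A leaf-to-ancestor minimum query is a pair $(v,u)$ with $v$ a leaf and $u$ an ancestor of $v$; a correct answer is (the identifier of) an edge of minimum value among the edges on the path of $T$ from $v$ to $u$. The depth of a vertex is the number of edges on the path from the root to it (so the root has depth $0$), and the height of $T$ is the maximum depth of a vertex. A deterministic data structure in the oracle model consists of a deterministic preprocessing phase, which receives $T$ and may make adaptively chosen oracle calls (each with two possible outcomes), followed by a deterministic query phase. With zero oracle calls at query time, the answer to each query depends only on $T$, on the query, and on the oracle outcomes seen during preprocessing. Only oracle calls are counted; all other computation is unrestricted. -}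

module Defs where

open import Data.Bool.Base using (Bool)
open import Data.Empty using (⊥-elim)
open import Data.Fin.Base using (Fin; zero; suc)
import Data.Integer.Base as ℤ
import Data.Integer.Properties as ℤ
open import Data.List.Base using (List; []; _∷_; length; map; allFin)
open import Data.List.Extrema.Nat using (max)
open import Data.List.Membership.Propositional using (_∈_)
open import Data.Nat.Base as ℕ using (ℕ; zero; suc)
import Data.Nat.Coprimality as Coprimality
import Data.Nat.Properties as ℕ
open import Data.Product.Base using (∃; ∃-syntax; _×_; _,_)
open import Data.Rational.Base
  using (ℚ; mkℚ; 0ℚ; 1ℚ; -_; _+_; _*_; _-_; _/_; 1/_; _<_; ↥_; ↧ₙ_;
         NonZero; Positive; Negative; NonNegative; nonNegative; nonPositive; positive; negative)
open import Data.Rational.Properties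
open import Data.Sum.Base using (_⊎_; inj₁; inj₂; [_,_]′)
open import Relation.Binary.Definitions using (tri<; tri≈; tri>)
open import Relation.Binary.PropositionalEquality
open import Relation.Nullary using (¬_; Dec; does; yes; no)

------------------------------------------------------------------------
-- Dedekind real numbers

record ℝ : Set₁ where
  field
    lower upper     : ℚ → Set
    lower-inhabited : ∃ lower
    upper-inhabited : ∃ upper
    lower-closed    : ∀ {p q} → p < q → lower q → lower p
    upper-closed    : ∀ {p q} → p < q → upper p → upper q
    lower-open      : ∀ {p} → lower p → ∃[ q ] p < q × lower q
    upper-open      : ∀ {q} → upper q → ∃[ p ] p < q × upper p
    disjoint        : ∀ {q} → lower q → ¬ upper q
    located         : ∀ {p q} → p < q → lower p ⊎ upper q

  lower<upper : ∀ {p q} → lower p → upper q → p < q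
  lower<upper {p} {q} l u with <-cmp p q
  ... | tri< p<q _ _  = p<q
  ... | tri≈ _ refl _ = ⊥-elim (disjoint l u)
  ... | tri> _ _ q<p  = ⊥-elim (disjoint l (upper-closed q<p u))

open ℝ

infix 4 _<ᴿ_ _≤ᴿ_

_<ᴿ_ : ℝ → ℝ → Set
x <ᴿ y = ∃[ q ] upper x q × lower y q

_≤ᴿ_ : ℝ → ℝ → Set
x ≤ᴿ y = ¬ (y <ᴿ x)

private
  q<q+1 : ∀ q → q < q + 1ℚ
  q<q+1 q = subst (_< q + 1ℚ) (+-identityʳ q)
              (+-monoʳ-< q {0ℚ} {1ℚ} (positive⁻¹ 1ℚ))

  q-1<q : ∀ q → q - 1ℚ < q
  q-1<q q = subst (q - 1ℚ <_) (+-identityʳ q)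
              (+-monoʳ-< q (negative⁻¹ (- 1ℚ)))

  below : ∀ p q → ∃[ r ] r < p × r < q
  below p q with ≤-total p q
  ... | inj₁ p≤q = p - 1ℚ , q-1<q p , <-≤-trans (q-1<q p) p≤q
  ... | inj₂ q≤p = q - 1ℚ , <-≤-trans (q-1<q q) q≤p , q-1<q q

  above : ∀ p q → ∃[ r ] p < r × q < r
  above p q with ≤-total p q
  ... | inj₁ p≤q = q + 1ℚ , ≤-<-trans p≤q (q<q+1 q) , q<q+1 q
  ... | inj₂ q≤p = p + 1ℚ , q<q+1 p , ≤-<-trans q≤p (q<q+1 p)

  dense-below : ∀ {r p q} → r < p → r < q → ∃[ s ] r < s × s < p × s < q
  dense-below {r} {p} {q} r<p r<q with ≤-total p q
  ... | inj₁ p≤q = let s , r<s , s<p = <-dense r<p in s , r<s , s<p , <-≤-trans s<p p≤q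
  ... | inj₂ q≤p = let s , r<s , s<q = <-dense r<q in s , r<s , <-≤-trans s<q q≤p , s<q

  dense-above : ∀ {r p q} → p < r → q < r → ∃[ s ] s < r × p < s × q < s
  dense-above {r} {p} {q} p<r q<r with ≤-total p q
  ... | inj₁ p≤q = let s , q<s , s<r = <-dense q<r in s , s<r , ≤-<-trans p≤q q<s , q<s
  ... | inj₂ q≤p = let s , p<s , s<r = <-dense p<r in s , s<r , p<s , ≤-<-trans q≤p p<s

fromℚ : ℚ → ℝ
fromℚ x = record
  { lower           = _< x
  ; upper           = x <_
  ; lower-inhabited = x - 1ℚ , q-1<q x
  ; upper-inhabited = x + 1ℚ , q<q+1 x
  ; lower-closed    = <-trans
  ; upper-closed    = λ p<q x<p → <-trans x<p p<q
  ; lower-open      = <-dense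
  ; upper-open      = λ x<q → let p , x<p , p<q = <-dense x<q in p , p<q , x<p
  ; disjoint        = <-asym
  ; located         = located′
  }
  where
  located′ : ∀ {p q} → p < q → p < x ⊎ x < q
  located′ {p} p<q with <-cmp p x
  ... | tri< p<x _ _  = inj₁ p<x
  ... | tri≈ _ refl _ = inj₂ p<q
  ... | tri> _ _ x<p  = inj₂ (<-trans x<p p<q)

ℕ→ℚ : ℕ → ℚ
ℕ→ℚ n = ℤ.+ n / 1

fromℕ : ℕ → ℝ
fromℕ n = fromℚ (ℕ→ℚ n)

private
  module Scale (r : ℚ) (x : ℝ) where

    L U : ℚ → Set
    L q = ∃[ p ] ∃[ p′ ] lower x p × upper x p′ × q < r * p × q < r * p′
    U q = ∃[ p ] ∃[ p′ ] lower x p × upper x p′ × r * p < q × r * p′ < q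

    r*[1/r*m] : .{{_ : NonZero r}} → ∀ m → r * (1/ r * m) ≡ m
    r*[1/r*m] m = begin
      r * (1/ r * m)  ≡⟨ sym (*-assoc r (1/ r) m) ⟩
      r * 1/ r * m    ≡⟨ cong (_* m) (*-inverseʳ r) ⟩
      1ℚ * m          ≡⟨ *-identityˡ m ⟩
      m               ∎
      where open ≡-Reasoning

    L-inhabited : ∃ L
    L-inhabited =
      let p  , l = lower-inhabited x
          p′ , u = upper-inhabited x
          q , q<rp , q<rp′ = below (r * p) (r * p′)
      in q , p , p′ , l , u , q<rp , q<rp′

    U-inhabited : ∃ U
    U-inhabited =
      let p  , l = lower-inhabited x
          p′ , u = upper-inhabited x
          q , rp<q , rp′<q = above (r * p) (r * p′)
      in q , p , p′ , l , u , rp<q , rp′<q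

    L-open : ∀ {p} → L p → ∃[ q ] p < q × L q
    L-open (p , p′ , l , u , i , j) =
      let q , k , i′ , j′ = dense-below i j in q , k , p , p′ , l , u , i′ , j′

    U-open : ∀ {q} → U q → ∃[ p ] p < q × U p
    U-open (p , p′ , l , u , i , j) =
      let q , k , i′ , j′ = dense-above i j in q , k , p , p′ , l , u , i′ , j′

    disjoint′ : ∀ {q} → L q → ¬ U q
    disjoint′ (p , p′ , l , u , q<rp , q<rp′) (s , s′ , m , v , rs<q , rs′<q)
      with ≤-total 0ℚ r
    ... | inj₁ 0≤r = <-irrefl refl (<-≤-trans (<-trans rs′<q q<rp)
          (*-monoˡ-≤-nonNeg r {{nonNegative 0≤r}} (<⇒≤ (lower<upper x l v))))
    ... | inj₂ r≤0 = <-irrefl refl (<-≤-trans (<-trans rs<q q<rp′)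
          (*-monoˡ-≤-nonPos r {{nonPositive r≤0}} (<⇒≤ (lower<upper x m u))))

    located-pos : .{{_ : Positive r}} → ∀ {a b} → a < b → L a ⊎ U b
    located-pos {a} {b} a<b
      with m , a<m , m<b ← <-dense a<b
      with m′ , m<m′ , m′<b ← <-dense m<b
      = go (located x s<s′)
      where
      instance _ = pos⇒nonZero r
      instance _ = 1/pos⇒pos r
      s<s′ : 1/ r * m < 1/ r * m′
      s<s′ = *-monoʳ-<-pos (1/ r) m<m′
      go : lower x (1/ r * m) ⊎ upper x (1/ r * m′) → L a ⊎ U b
      go (inj₁ l) =
        let p′ , u = upper-inhabited x
            a<rs = subst (a <_) (sym (r*[1/r*m] m)) a<m
        in inj₁ (_ , p′ , l , u , a<rs ,
                 <-trans a<rs (*-monoʳ-<-pos r (lower<upper x l u)))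
      go (inj₂ u) =
        let p , l = lower-inhabited x
            rs<b = subst (_< b) (sym (r*[1/r*m] m′)) m′<b
        in inj₂ (p , _ , l , u ,
                 <-trans (*-monoʳ-<-pos r (lower<upper x l u)) rs<b , rs<b)

    located-neg : .{{_ : Negative r}} → ∀ {a b} → a < b → L a ⊎ U b
    located-neg {a} {b} a<b
      with m , a<m , m<b ← <-dense a<b
      with m′ , m<m′ , m′<b ← <-dense m<b
      = go (located x s′<s)
      where
      instance _ = neg⇒nonZero r
      instance _ = 1/neg⇒neg r
      s′<s : 1/ r * m′ < 1/ r * m
      s′<s = *-monoʳ-<-neg (1/ r) m<m′
      go : lower x (1/ r * m′) ⊎ upper x (1/ r * m) → L a ⊎ U b
      go (inj₁ l) =
        let p′ , u = upper-inhabited x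
            rs<b = subst (_< b) (sym (r*[1/r*m] m′)) m′<b
        in inj₂ (_ , p′ , l , u , rs<b ,
                 <-trans (*-monoʳ-<-neg r (lower<upper x l u)) rs<b)
      go (inj₂ u) =
        let p , l = lower-inhabited x
            a<rs = subst (a <_) (sym (r*[1/r*m] m)) a<m
        in inj₁ (p , _ , l , u ,
                 <-trans a<rs (*-monoʳ-<-neg r (lower<upper x l u)) , a<rs)

    located-zero : r ≡ 0ℚ → ∀ {a b} → a < b → L a ⊎ U b
    located-zero r≡0 {a} {b} a<b =
      let p  , l = lower-inhabited x
          p′ , u = upper-inhabited x
          r*_≡0 = λ q → trans (cong (_* q) r≡0) (*-zeroˡ q)
      in [ (λ a<0 → inj₁ (p , p′ , l , u ,
              subst (a <_) (sym (r*_≡0 p)) a<0 , subst (a <_) (sym (r*_≡0 p′)) a<0))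
         , (λ 0<b → inj₂ (p , p′ , l , u ,
              subst (_< b) (sym (r*_≡0 p)) 0<b , subst (_< b) (sym (r*_≡0 p′)) 0<b))
         ]′ (located (fromℚ 0ℚ) a<b)

    located′ : ∀ {a b} → a < b → L a ⊎ U b
    located′ with <-cmp r 0ℚ
    ... | tri< r<0 _ _ = located-neg {{negative r<0}}
    ... | tri≈ _ r≡0 _ = located-zero r≡0
    ... | tri> _ _ 0<r = located-pos {{positive 0<r}}

infixr 7 _·_

-- The product of a rational r and a real x, by interval arithmetic: both
-- endpoints r * p and r * p′ occur because r may have either sign.
_·_ : ℚ → ℝ → ℝ
r · x = record
  { lower           = L
  ; upper           = U
  ; lower-inhabited = L-inhabited
  ; upper-inhabited = U-inhabited
  ; lower-closed    = λ k (p , p′ , l , u , i , j) →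
                        p , p′ , l , u , <-trans k i , <-trans k j
  ; upper-closed    = λ k (p , p′ , l , u , i , j) →
                        p , p′ , l , u , <-trans i k , <-trans j k
  ; lower-open      = L-open
  ; upper-open      = U-open
  ; disjoint        = disjoint′
  ; located         = located′
  }
  where open Scale r x

private
  module Log₂ (h : ℕ) .{{_ : ℕ.NonZero h}} where

    -- For s = a/b with a ≥ 0 and b > 0, 2 ^ s ≤ h iff 2 ^ a ≤ h ^ b,
    -- and h ≤ 2 ^ s iff h ^ b ≤ 2 ^ a.  Since h ≥ 1, log₂ h ≥ 0, so
    -- nonnegative s determine both cuts.
    L U : ℚ → Set
    L q = ∃[ s ] NonNegative s × q < s × 2 ℕ.^ ℤ.∣ ↥ s ∣ ℕ.≤ h ℕ.^ ↧ₙ s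
    U q = ∃[ s ] NonNegative s × s < q × h ℕ.^ ↧ₙ s ℕ.≤ 2 ℕ.^ ℤ.∣ ↥ s ∣

    0∈ : 2 ℕ.^ ℤ.∣ ↥ 0ℚ ∣ ℕ.≤ h ℕ.^ ↧ₙ 0ℚ
    0∈ = subst (1 ℕ.≤_) (sym (ℕ.*-identityʳ h)) (ℕ.>-nonZero⁻¹ h)

    n≤2^n : ∀ n → n ℕ.≤ 2 ℕ.^ n
    n≤2^n zero    = ℕ.z≤n
    n≤2^n (suc n) = ℕ.+-mono-≤ (ℕ.m^n>0 2 n)
      (ℕ.≤-trans (n≤2^n n) (ℕ.≤-reflexive (sym (ℕ.+-identityʳ (2 ℕ.^ n)))))

    U-inhabited : ∃ U
    U-inhabited = s + 1ℚ , s , _ , q<q+1 s ,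
      subst (ℕ._≤ 2 ℕ.^ h) (sym (ℕ.*-identityʳ h)) (n≤2^n h)
      where s = mkℚ (ℤ.+ h) 0 (Coprimality.sym (Coprimality.1-coprimeTo h))

    disjoint′ : ∀ {q} → L q → ¬ U q
    disjoint′ {q} (s@(mkℚ (ℤ.+ a) b-1 _) , _ , q<s , 2^a≤h^b)
                  (t@(mkℚ (ℤ.+ c) d-1 _) , _ , t<q , h^d≤2^c) =
      ℕ.<⇒≱ 2^[cb]<2^[ad] 2^[ad]≤2^[cb]
      where
      b = suc b-1
      d = suc d-1
      cb<ad : c ℕ.* b ℕ.< a ℕ.* d
      cb<ad = ℤ.drop‿+<+ (subst₂ ℤ._<_ (sym (ℤ.pos-* c b)) (sym (ℤ.pos-* a d))
                (drop-*<* (<-trans t<q q<s)))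
      2^[cb]<2^[ad] : 2 ℕ.^ (c ℕ.* b) ℕ.< 2 ℕ.^ (a ℕ.* d)
      2^[cb]<2^[ad] = ℕ.^-monoʳ-< 2 (ℕ.s≤s (ℕ.s≤s ℕ.z≤n)) cb<ad
      2^[ad]≤2^[cb] : 2 ℕ.^ (a ℕ.* d) ℕ.≤ 2 ℕ.^ (c ℕ.* b)
      2^[ad]≤2^[cb] = begin
        2 ℕ.^ (a ℕ.* d)    ≡⟨ sym (ℕ.^-*-assoc 2 a d) ⟩
        (2 ℕ.^ a) ℕ.^ d    ≤⟨ ℕ.^-monoˡ-≤ d 2^a≤h^b ⟩
        (h ℕ.^ b) ℕ.^ d    ≡⟨ ℕ.^-*-assoc h b d ⟩
        h ℕ.^ (b ℕ.* d)    ≡⟨ cong (h ℕ.^_) (ℕ.*-comm b d) ⟩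
        h ℕ.^ (d ℕ.* b)    ≡⟨ sym (ℕ.^-*-assoc h d b) ⟩
        (h ℕ.^ d) ℕ.^ b    ≤⟨ ℕ.^-monoˡ-≤ b h^d≤2^c ⟩
        (2 ℕ.^ c) ℕ.^ b    ≡⟨ ℕ.^-*-assoc 2 c b ⟩
        2 ℕ.^ (c ℕ.* b)    ∎
        where open ℕ.≤-Reasoning

    located′ : ∀ {p q} → p < q → L p ⊎ U q
    located′ {p} {q} p<q with p <? 0ℚ
    ... | yes p<0 = inj₁ (0ℚ , _ , p<0 , 0∈)
    ... | no  p≮0 with s , p<s , s<q ← <-dense p<q
                  with s≥0 ← nonNegative (<⇒≤ (≤-<-trans (≮⇒≥ p≮0) p<s))
                  with ℕ.≤-total (2 ℕ.^ ℤ.∣ ↥ s ∣) (h ℕ.^ ↧ₙ s)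
    ...   | inj₁ 2^a≤h^b = inj₁ (s , s≥0 , p<s , 2^a≤h^b)
    ...   | inj₂ h^b≤2^a = inj₂ (s , s≥0 , s<q , h^b≤2^a)

-- log₂ 0 is set to 0.
log₂ : ℕ → ℝ
log₂ zero      = fromℚ 0ℚ
log₂ h@(suc _) = record
  { lower           = L
  ; upper           = U
  ; lower-inhabited = 0ℚ - 1ℚ , 0ℚ , _ , q-1<q 0ℚ , 0∈
  ; upper-inhabited = U-inhabited
  ; lower-closed    = λ p<q (s , s≥0 , q<s , i) → s , s≥0 , <-trans p<q q<s , i
  ; upper-closed    = λ p<q (s , s≥0 , s<p , i) → s , s≥0 , <-trans s<p p<q , i
  ; lower-open      = λ (s , s≥0 , p<s , i) →
                        let q , p<q , q<s = <-dense p<s in q , p<q , s , s≥0 , q<s , i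
  ; upper-open      = λ (s , s≥0 , s<q , i) →
                        let p , s<p , p<q = <-dense s<q in p , p<q , s , s≥0 , s<p , i
  ; disjoint        = disjoint′
  ; located         = located′
  }
  where open Log₂ h

------------------------------------------------------------------------
-- Rooted trees

-- The vertices are Fin (suc m) with root zero.  Each other vertex suc e
-- has a single edge to its parent; e serves as the identifier of that
-- edge.  A Path from v to u climbs from v to its ancestor u.
data Path {m} (parent : Fin m → Fin (suc m)) (u : Fin (suc m)) :
          Fin (suc m) → Set where
  []  : Path parent u u
  _∷_ : ∀ e → Path parent u (parent e) → Path parent u (suc e)

pathEdges : ∀ {m} {parent : Fin m → Fin (suc m)} {u v} → Path parent u v → List (Fin m)
pathEdges []      = []
pathEdges (e ∷ p) = e ∷ pathEdges p

-- The field rooted excludes cycles: every vertex descends from the root.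
record RootedTree : Set where
  field
    edges  : ℕ
    parent : Fin edges → Fin (suc edges)
    rooted : ∀ v → Path parent zero v

  Edge Vertex : Set
  Edge   = Fin edges
  Vertex = Fin (suc edges)

  nodes : ℕ
  nodes = suc edges

  depth : Vertex → ℕ
  depth v = length (pathEdges (rooted v))

  height : ℕ
  height = max 0 (map depth (allFin nodes))

  IsLeaf : Vertex → Set
  IsLeaf v = ∀ e → parent e ≢ v

open RootedTree

-- The ancestor is required to be proper, since a path without edges has no
-- minimum.
record Query (T : RootedTree) : Set where
  field
    leaf     : Vertex T
    ancestor : Vertex T
    isLeaf   : IsLeaf T leaf
    path     : Path (parent T) ancestor leaf
    proper   : ancestor ≢ leaf

------------------------------------------------------------------------
-- The oracle model

-- The order of ℝ is not constructively decidable, so the oracle is given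
-- along with the hidden values.
record EdgeValues (T : RootedTree) : Set₁ where
  field
    value  : Edge T → ℝ
    decide : ∀ e f → Dec (value e <ᴿ value f)

  oracle : Edge T → Edge T → Bool
  oracle e f = does (decide e f)

open EdgeValues

IsMinimum : ∀ {T} → EdgeValues T → List (Edge T) → Edge T → Set
IsMinimum W es e = e ∈ es × (∀ {f} → f ∈ es → value W e ≤ᴿ value W f)

data Preprocessing (E : Set) : Set where
  stop    : Preprocessing E
  compare : (e f : E) (continue : Bool → Preprocessing E) → Preprocessing E

outcomes : ∀ {E} → Preprocessing E → (E → E → Bool) → List Bool
outcomes stop                   O = []
outcomes (compare e f continue) O = O e f ∷ outcomes (continue (O e f)) O

-- The preprocessing needs no explicit result: its outcome list, together
-- with T, determines everything it may have computed.
record DataStructure : Set where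
  field
    preprocess : (T : RootedTree) → Preprocessing (Edge T)
    answer     : (T : RootedTree) → List Bool → Query T → Edge T

  transcript : (T : RootedTree) → EdgeValues T → List Bool
  transcript T W = outcomes (preprocess T) (oracle W)

  oracleCalls : (T : RootedTree) → EdgeValues T → ℕ
  oracleCalls T W = length (transcript T W)

  CorrectOn : (T : RootedTree) → EdgeValues T → Set
  CorrectOn T W = (Q : Query T) →
    IsMinimum W (pathEdges (Query.path Q)) (answer T (transcript T W) Q)

{-# OPTIONS --safe #-}

-- The hard instance is a broom: a path of k ≈ h/2 edges hanging from the
-- root, with L ≥ n/4 further edges attached to its lower end.  The values
-- along the path increase downwards, so the minimum from a leaf to the i-th
-- path vertex is either the leaf edge or the i-th path edge, and the answers
-- reveal the rank of every leaf edge among the path edges.  These ranks are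
-- independent, so the (k+1)^L rank assignments have pairwise distinct
-- transcripts, and one of them takes at least L log₂ (k+1) oracle calls.
-- Since (k+1)² ≥ h, this is at least (n/4) (log₂ h)/2.
module Submission where

open import Defs
open import Data.Bool.Base using (Bool; true; false)
import Data.Bool.Properties as Bool
open import Data.Fin.Base using (Fin; zero; suc; toℕ; inject₁; _↑ˡ_; _↑ʳ_; splitAt; finToFun; funToFin; fromℕ<; combine)
import Data.Fin.Properties as Fin
open import Data.Integer.Base using (+_)
import Data.Integer.Base as ℤ
import Data.Integer.Properties as ℤ
open import Data.List.Base using (List; []; _∷_; length; map; filter; allFin)
open import Data.List.Extrema.Nat using (max≤v⁺)
import Data.List.Properties as List
open import Data.List.Membership.Propositional using (_∈_)
open import Data.List.Membership.Propositional.Properties using (∈-filter⁻)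
import Data.List.Relation.Unary.All as All
import Data.List.Relation.Unary.All.Properties as All
open import Data.List.Relation.Unary.All using (All)
open import Data.List.Relation.Unary.AllPairs using (_∷_)
open import Data.List.Relation.Unary.Any using (here; there)
open import Data.List.Relation.Unary.Unique.Propositional using (Unique)
import Data.List.Relation.Unary.Unique.Propositional.Properties as Unique
open import Data.Nat.Base as ℕ using (ℕ; zero; suc; z≤n; s≤s; _≤_; _∸_; _^_; ⌊_/2⌋; ⌈_/2⌉)
import Data.Nat.Coprimality as Coprimality
import Data.Nat.Properties as ℕ
open import Data.Nat.Solver using (module +-*-Solver)
open import Data.Product.Base using (∃-syntax; _×_; _,_; proj₁; proj₂)
open import Data.Rational.Base using (ℚ; mkℚ; *<*; toℚᵘ; Positive; NonNegative; _*_; _<_; _/_; ↥_; ↧ₙ_)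
import Data.Rational.Properties as ℚ
import Data.Rational.Unnormalised.Base as ℚᵘ
import Data.Rational.Unnormalised.Properties as ℚᵘ
open import Data.Sum.Base using (inj₁; inj₂; [_,_]′)
open import Function.Base using (_∘_)
open import Relation.Binary.Definitions using (tri<; tri≈; tri>)
open import Relation.Binary.PropositionalEquality
open import Relation.Nullary using (¬_; contradiction)
open import Relation.Nullary.Decidable using (map′)
open RootedTree using (nodes; height; depth)
open DataStructure using (CorrectOn; oracleCalls; preprocess; answer; transcript)
open EdgeValues using (value)

-- Decision trees

length-filter-≟ : ∀ {A : Set} (q : A → Bool) (xs : List A) →
  length xs ≡ length (filter (λ a → q a Bool.≟ true) xs)
              ℕ.+ length (filter (λ a → q a Bool.≟ false) xs)
length-filter-≟ q [] = refl
length-filter-≟ q (x ∷ xs) with q x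
... | true  = cong suc (length-filter-≟ q xs)
... | false = trans (cong suc (length-filter-≟ q xs)) (sym (ℕ.+-suc _ _))

larger-half : ∀ {A : Set} (q : A → Bool) (xs : List A) →
  ∃[ b ] length xs ≤ 2 ℕ.* length (filter (λ a → q a Bool.≟ b) xs)
larger-half q xs with ℕ.≤-total (length (filter (λ a → q a Bool.≟ true) xs))
                                (length (filter (λ a → q a Bool.≟ false) xs))
... | inj₁ t≤f = false , (begin
  length xs        ≡⟨ length-filter-≟ q xs ⟩
  _ ℕ.+ l          ≤⟨ ℕ.+-mono-≤ t≤f (ℕ.≤-reflexive (sym (ℕ.+-identityʳ l))) ⟩
  2 ℕ.* l          ∎)
  where open ℕ.≤-Reasoning
        l = length (filter (λ a → q a Bool.≟ false) xs)
... | inj₂ f≤t = true , (begin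
  length xs        ≡⟨ length-filter-≟ q xs ⟩
  l ℕ.+ _          ≤⟨ ℕ.+-monoʳ-≤ l (ℕ.≤-trans f≤t (ℕ.≤-reflexive (sym (ℕ.+-identityʳ l)))) ⟩
  2 ℕ.* l          ∎)
  where open ℕ.≤-Reasoning
        l = length (filter (λ a → q a Bool.≟ true) xs)

-- An adversary argument: each comparison is answered so as to keep the larger
-- half of the inputs.
outcomes-lower-bound : ∀ {A E : Set} (P : Preprocessing E) (O : A → E → E → Bool) (xs : List A) →
  1 ≤ length xs → Unique xs →
  (∀ {a b} → a ∈ xs → b ∈ xs → outcomes P (O a) ≡ outcomes P (O b) → a ≡ b) →
  ∃[ a ] a ∈ xs × length xs ≤ 2 ^ length (outcomes P (O a))
-- At a leaf of the decision tree all inputs share the empty transcript, so injectivity leaves only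
-- one.
outcomes-lower-bound stop O (x ∷ []) _ _ _ = x , here refl , ℕ.≤-refl
outcomes-lower-bound stop O (x ∷ y ∷ xs) _ ((x≢y All.∷ _) ∷ _) inj =
  contradiction (inj (here refl) (there (here refl)) refl) x≢y
outcomes-lower-bound (compare e f continue) O xs 1≤xs uniq inj =
  let a , a∈ys , ys≤ = outcomes-lower-bound (continue b) O ys
        (ℕ.*-cancelˡ-< 2 0 _ (ℕ.≤-trans 1≤xs xs≤2ys))
        (Unique.filter⁺ q≟b uniq)
        (λ {a} {a′} a∈ a′∈ eq →
           let a∈xs , p = ys⁻ a∈ ; a′∈xs , p′ = ys⁻ a′∈
           in inj a∈xs a′∈xs
                (trans (along a p) (trans (cong (b ∷_) eq) (sym (along a′ p′)))))
      a∈xs , p = ys⁻ a∈ys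
  in a , a∈xs , (begin
    length xs                                               ≤⟨ xs≤2ys ⟩
    2 ℕ.* length ys                                         ≤⟨ ℕ.*-monoʳ-≤ 2 ys≤ ⟩
    2 ^ length (b ∷ outcomes (continue b) (O a))            ≡⟨ cong (λ l → 2 ^ length l) (sym (along a p)) ⟩
    2 ^ length (outcomes (compare e f continue) (O a))      ∎)
  where
  open ℕ.≤-Reasoning
  half = larger-half (λ a → O a e f) xs
  b = proj₁ half
  xs≤2ys = proj₂ half
  q≟b = λ a → O a e f Bool.≟ b
  ys = filter q≟b xs
  ys⁻ = λ {a} → ∈-filter⁻ q≟b {v = a} {xs = xs}
  along : ∀ {b} a → O a e f ≡ b →
    outcomes (compare e f continue) (O a) ≡ b ∷ outcomes (continue b) (O a)
  along a refl = refl

-- Brooms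

module Broom where

  -- The vertices 0, …, k form the path, and the edges e ≥ k are the bristles.
  parent : ∀ k {L} → Fin (k ℕ.+ L) → Fin (suc (k ℕ.+ L))
  parent zero    e       = zero
  parent (suc k) zero    = zero
  parent (suc k) (suc e) = suc (parent k e)

  -- A broom with `suc k` path edges is edge `zero` with a broom of `k` path edges hung from its
  -- lower end. On edges and on vertices, `suc` is the embedding of the smaller broom.
  lift : ∀ {k L u v} → Path (parent k {L}) u v → Path (parent (suc k) {L}) (suc u) (suc v)
  lift []      = []
  lift (e ∷ p) = suc e ∷ lift p

  -- suc zero is the lower end of edge zero.
  lift-root : ∀ {k L v} → Path (parent k {L}) zero v → Path (parent (suc k) {L}) zero (suc v)
  lift-root []      = zero ∷ []
  lift-root (e ∷ p) = suc e ∷ lift-root p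

  rooted : ∀ k {L} v → Path (parent k {L}) zero v
  rooted k       zero    = []
  rooted zero    (suc e) = e ∷ []
  rooted (suc k) (suc v) = lift-root (rooted k v)

  length-lift-root : ∀ {k L v} (p : Path (parent k {L}) zero v) →
    length (pathEdges (lift-root p)) ≡ suc (length (pathEdges p))
  length-lift-root []      = refl
  length-lift-root (e ∷ p) = cong suc (length-lift-root p)

  depth≤ : ∀ k {L} v → length (pathEdges (rooted k {L} v)) ≤ suc k
  depth≤ k       zero    = z≤n
  depth≤ zero    (suc e) = s≤s z≤n
  depth≤ (suc k) (suc v) = ℕ.≤-trans (ℕ.≤-reflexive (length-lift-root (rooted k v))) (s≤s (depth≤ k v))

  bristle-isLeaf : ∀ k {L} (j : Fin L) e → parent k e ≢ suc (k ↑ʳ j)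
  bristle-isLeaf zero    j e       ()
  bristle-isLeaf (suc k) j zero    ()
  bristle-isLeaf (suc k) j (suc e) eq = bristle-isLeaf k j e (Fin.suc-injective eq)

  bristle≢spine : ∀ {k L} (i : Fin k) (j : Fin L) → inject₁ (i ↑ˡ L) ≢ suc (k ↑ʳ j)
  bristle≢spine zero    j ()
  bristle≢spine (suc i) j eq = bristle≢spine i j (Fin.suc-injective eq)

  -- Path edge `i` joins vertices i and i + 1, so `inject₁ (i ↑ˡ L)` is its upper end and the climb
  -- finishes with that edge.
  climb : ∀ {k L} (i : Fin k) (j : Fin L) → Path (parent k) (inject₁ (i ↑ˡ L)) (suc (k ↑ʳ j))
  climb {suc k} zero    j = rooted (suc k) (suc (suc k ↑ʳ j))
  climb {suc k} (suc i) j = lift (climb i j)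

  -- The bound `i` is a number rather than an element of `Fin k`, so that it can be 0 in the base
  -- case `k = 0` of `rooted-OnClimb`.
  data OnClimb {k L} (i : ℕ) (j : Fin L) : Fin (k ℕ.+ L) → Set where
    bristle : OnClimb i j (k ↑ʳ j)
    spine   : ∀ i′ → i ≤ toℕ i′ → OnClimb i j (i′ ↑ˡ L)

  OnClimb-suc : ∀ {k L i} {j : Fin L} {e} → OnClimb {k} i j e → OnClimb {suc k} (suc i) j (suc e)
  OnClimb-suc bristle        = bristle
  OnClimb-suc (spine i′ i≤i′) = spine (suc i′) (s≤s i≤i′)

  OnClimb-zero : ∀ {k L i} {j : Fin L} {e} → OnClimb {k} i j e → OnClimb {k} 0 j e
  OnClimb-zero bristle      = bristle
  OnClimb-zero (spine i′ _) = spine i′ z≤n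

  lift-All : ∀ {k L u v} {Q : Fin (suc k ℕ.+ L) → Set} (p : Path (parent k {L}) u v) →
    All (Q ∘ suc) (pathEdges p) → All Q (pathEdges (lift p))
  lift-All []      All.[]         = All.[]
  lift-All (e ∷ p) (qe All.∷ qs) = qe All.∷ lift-All p qs

  lift-root-All : ∀ {k L v} {Q : Fin (suc k ℕ.+ L) → Set} (p : Path (parent k {L}) zero v) →
    Q zero → All (Q ∘ suc) (pathEdges p) → All Q (pathEdges (lift-root p))
  lift-root-All []      q0 All.[]        = q0 All.∷ All.[]
  lift-root-All (e ∷ p) q0 (qe All.∷ qs) = qe All.∷ lift-root-All p q0 qs

  rooted-OnClimb : ∀ k {L} (j : Fin L) → All (OnClimb {k} 0 j) (pathEdges (rooted k (suc (k ↑ʳ j))))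
  rooted-OnClimb zero    j = bristle All.∷ All.[]
  rooted-OnClimb (suc k) j = lift-root-All (rooted k (suc (k ↑ʳ j))) (spine zero z≤n)
    (All.map (OnClimb-zero ∘ OnClimb-suc) (rooted-OnClimb k j))

  climb-OnClimb : ∀ {k L} (i : Fin k) (j : Fin L) → All (OnClimb {k} (toℕ i) j) (pathEdges (climb i j))
  climb-OnClimb {suc k} zero    j = rooted-OnClimb (suc k) j
  climb-OnClimb {suc k} (suc i) j = lift-All (climb i j) (All.map OnClimb-suc (climb-OnClimb i j))

  lift-∈ : ∀ {k L u v e} (p : Path (parent k {L}) u v) → e ∈ pathEdges p → suc e ∈ pathEdges (lift p)
  lift-∈ (e ∷ p) (here refl) = here refl
  lift-∈ (e ∷ p) (there e∈)  = there (lift-∈ p e∈)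

  zero∈lift-root : ∀ {k L v} (p : Path (parent k {L}) zero v) → zero ∈ pathEdges (lift-root p)
  zero∈lift-root []      = here refl
  zero∈lift-root (e ∷ p) = there (zero∈lift-root p)

  spine∈climb : ∀ {k L} (i : Fin k) (j : Fin L) → i ↑ˡ L ∈ pathEdges (climb i j)
  spine∈climb {suc k} zero    j = zero∈lift-root (rooted k (suc (k ↑ʳ j)))
  spine∈climb {suc k} (suc i) j = lift-∈ (climb i j) (spine∈climb i j)

  first∈ : ∀ {m u e} {parent : Fin m → Fin (suc m)} (p : Path parent u (suc e)) →
    u ≢ suc e → e ∈ pathEdges p
  first∈ []      u≢u = contradiction refl u≢u
  first∈ (e ∷ p) _   = here refl

  bristle∈climb : ∀ {k L} (i : Fin k) (j : Fin L) → k ↑ʳ j ∈ pathEdges (climb i j)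
  bristle∈climb i j = first∈ (climb i j) (bristle≢spine i j)

open Broom using (OnClimb; bristle; spine; climb; climb-OnClimb; spine∈climb; bristle∈climb)

broom : ℕ → ℕ → RootedTree
broom k L = record { edges = k ℕ.+ L ; parent = Broom.parent k ; rooted = Broom.rooted k }

height-broom : ∀ k L → height (broom k L) ≤ suc k
height-broom k L = max≤v⁺ z≤n (All.map⁺ {f = depth (broom k L)} (All.universal (Broom.depth≤ k) (allFin _)))

query : ∀ {k L} → Fin k → Fin L → Query (broom k L)
query {k} i j = record
  { leaf = suc (k ↑ʳ j) ; ancestor = _ ; isLeaf = Broom.bristle-isLeaf k j
  ; path = climb i j ; proper = Broom.bristle≢spine i j }

-- Values

-- ℕ→ℚ n with the normalisation carried out, so that it computes.
natℚ : ℕ → ℚ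
natℚ n = mkℚ (+ n) 0 (Coprimality.sym (Coprimality.1-coprimeTo n))

fromℚ-mono-< : ∀ {p q} → p < q → fromℚ p <ᴿ fromℚ q
fromℚ-mono-< = ℚ.<-dense

natValues : ∀ {T} → (RootedTree.Edge T → ℕ) → EdgeValues T
natValues w = record
  { value  = λ e → fromℚ (natℚ (w e))
  ; decide = λ e f → map′ fromℚ-mono-< (λ (_ , p , q) → ℚ.<-trans p q) (natℚ (w e) ℚ.<? natℚ (w f))
  }

natValues-≤ : ∀ {T} (w : RootedTree.Edge T → ℕ) e f →
  value (natValues {T} w) e ≤ᴿ value (natValues {T} w) f → w e ≤ w f
natValues-≤ w e f e≤f = ℕ.≮⇒≥ λ wf<we → e≤f (fromℚ-mono-< (*<* (subst₂ ℤ._<_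
  (sym (ℤ.*-identityʳ _)) (sym (ℤ.*-identityʳ _)) (ℤ.+<+ wf<we))))

module _ {k L : ℕ} (rank : Fin L → Fin (suc k)) where

  -- Odd values on the path leave even gaps for the bristles: 2i + 1 < 2r exactly when i < r, so a
  -- bristle of rank r exceeds precisely the first r path edges.
  weight : Fin (k ℕ.+ L) → ℕ
  weight e = [ (λ i → suc (2 ℕ.* toℕ i)) , (λ j → 2 ℕ.* toℕ (rank j)) ]′ (splitAt k e)

  weight-spine : ∀ i → weight (i ↑ˡ L) ≡ suc (2 ℕ.* toℕ i)
  weight-spine i rewrite Fin.splitAt-↑ˡ k i L = refl

  weight-bristle : ∀ j → weight (k ↑ʳ j) ≡ 2 ℕ.* toℕ (rank j)
  weight-bristle j rewrite Fin.splitAt-↑ʳ k L j = refl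

  weights : EdgeValues (broom k L)
  weights = natValues weight

-- With i the smaller rank, path edge i lies strictly between the two values of
-- bristle j.
no-common-minimum : ∀ {k L} (r r′ : Fin L → Fin (suc k)) (i : Fin k) (j : Fin L) a →
  toℕ i ≡ toℕ (r j) → toℕ (r j) ℕ.< toℕ (r′ j) →
  IsMinimum (weights r)  (pathEdges (climb i j)) a →
  ¬ IsMinimum (weights r′) (pathEdges (climb i j)) a
no-common-minimum {k} {L} r r′ i j a i≡r r<r′ (a∈ , min) (_ , min′) with All.lookup (climb-OnClimb i j) a∈
-- Under `r`, bristle `j` is smaller than every path edge from `i` downwards.
... | spine i′ i≤i′ = ℕ.<⇒≱ (s≤s (ℕ.*-monoʳ-≤ 2 (ℕ.≤-trans (ℕ.≤-reflexive (sym i≡r)) i≤i′)))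
  (subst₂ _≤_ (weight-spine r i′) (weight-bristle r j)
     (natValues-≤ {broom k L} (weight r) (i′ ↑ˡ L) (k ↑ʳ j) (min (bristle∈climb i j))))
-- Under `r′`, bristle `j` has value at least 2(i + 1), above the 2i + 1 of path edge `i`.
... | bristle = ℕ.<⇒≱ (s≤s (ℕ.≤-reflexive (cong (2 ℕ.*_) i≡r)))
   (ℕ.≤-pred (ℕ.≤-trans (ℕ.≤-reflexive (sym (ℕ.*-suc 2 _))) (ℕ.≤-trans (ℕ.*-monoʳ-≤ 2 r<r′)
   (subst₂ _≤_ (weight-bristle r′ j) (weight-spine r′ i)
     (natValues-≤ {broom k L} (weight r′) (k ↑ʳ j) (i ↑ˡ L) (min′ (spine∈climb i j)))))))

-- Transcripts determine ranks

module _ {k L} (D : DataStructure) (correct : ∀ r → CorrectOn D (broom k L) (weights r)) where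

  -- Equal transcripts force equal answers, so a single edge would be a minimum under both
  -- assignments, for the query that ends at the top of the path edge numbered by the smaller rank.
  transcript≡⇒≮ : ∀ r r′ → transcript D (broom k L) (weights r) ≡ transcript D (broom k L) (weights r′) →
    ∀ j → toℕ (r j) ℕ.≮ toℕ (r′ j)
  transcript≡⇒≮ r r′ t≡t′ j r<r′ = no-common-minimum r r′ i j (answer D (broom k L) _ (query i j))
    (Fin.toℕ-fromℕ< r<k) r<r′ (correct r (query i j))
    (subst (λ t → IsMinimum (weights r′) (pathEdges (climb i j)) (answer D (broom k L) t (query i j)))
       (sym t≡t′) (correct r′ (query i j)))
    where
    -- Ranks go up to k but path edges only to k - 1; being the smaller of two ranks, `r j` does
    -- number a path edge.
    r<k = ℕ.<-≤-trans r<r′ (Fin.toℕ≤pred[n] (r′ j))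
    i = fromℕ< r<k

  transcript≡⇒≗ : ∀ r r′ → transcript D (broom k L) (weights r) ≡ transcript D (broom k L) (weights r′) →
    ∀ j → r j ≡ r′ j
  transcript≡⇒≗ r r′ t≡t′ j with ℕ.<-cmp (toℕ (r j)) (toℕ (r′ j))
  ... | tri< r<r′ _ _ = contradiction r<r′ (transcript≡⇒≮ r r′ t≡t′ j)
  ... | tri≈ _ r≡r′ _ = Fin.toℕ-injective r≡r′
  ... | tri> _ _ r′<r = contradiction r′<r (transcript≡⇒≮ r′ r (sym t≡t′) j)

  -- The rank assignments are enumerated by codes in `Fin (suc k ^ L)`: equal transcripts yield only
  -- pointwise equality of ranks, which `funToFin-cong` turns into equality of codes.
  broom-lower-bound : ∃[ r ] suc k ^ L ≤ 2 ^ oracleCalls D (broom k L) (weights r)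
  broom-lower-bound =
    let a , _ , N≤ = outcomes-lower-bound (preprocess D (broom k L))
          (λ a → EdgeValues.oracle {broom k L} (weights (ranks a))) (allFin N)
          (subst (1 ≤_) (sym length-allFin) (ℕ.m^n>0 (suc k) L))
          (Unique.allFin⁺ N)
          (λ {a} {b} _ _ eq → trans (sym (Fin.funToFin-finToFin {L} a))
             (trans (funToFin-cong (transcript≡⇒≗ (ranks a) (ranks b) eq))
                    (Fin.funToFin-finToFin {L} b)))
    in ranks a , ℕ.≤-trans (ℕ.≤-reflexive (sym length-allFin)) N≤
    where
    N = suc k ^ L
    ranks : Fin N → Fin L → Fin (suc k)
    ranks = finToFun
    length-allFin : length (allFin N) ≡ N
    length-allFin = List.length-tabulate {n = N} _
    funToFin-cong : ∀ {m n} {f g : Fin m → Fin n} → (∀ i → f i ≡ g i) → funToFin f ≡ funToFin g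
    funToFin-cong {zero}  f≗g = refl
    funToFin-cong {suc m} f≗g = cong₂ combine (f≗g zero) (funToFin-cong (f≗g ∘ suc))

-- Arithmetic

⌊n/2⌋+⌊n/2⌋≤n : ∀ n → ⌊ n /2⌋ ℕ.+ ⌊ n /2⌋ ≤ n
⌊n/2⌋+⌊n/2⌋≤n n = ℕ.≤-trans (ℕ.+-monoʳ-≤ ⌊ n /2⌋ (ℕ.⌊n/2⌋≤⌈n/2⌉ n))
                    (ℕ.≤-reflexive (ℕ.⌊n/2⌋+⌈n/2⌉≡n n))

⌈n/2⌉≤1+⌊n/2⌋ : ∀ n → ⌈ n /2⌉ ≤ suc ⌊ n /2⌋
⌈n/2⌉≤1+⌊n/2⌋ zero          = z≤n
⌈n/2⌉≤1+⌊n/2⌋ (suc zero)    = s≤s z≤n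
⌈n/2⌉≤1+⌊n/2⌋ (suc (suc n)) = s≤s (⌈n/2⌉≤1+⌊n/2⌋ n)

h≤[1+⌊h/2⌋]² : ∀ h → h ≤ suc ⌊ h /2⌋ ^ 2
h≤[1+⌊h/2⌋]² h = begin
  h                            ≡⟨ sym (ℕ.⌊n/2⌋+⌈n/2⌉≡n h) ⟩
  k ℕ.+ ⌈ h /2⌉                ≤⟨ ℕ.+-monoʳ-≤ k (⌈n/2⌉≤1+⌊n/2⌋ h) ⟩
  k ℕ.+ suc k                  ≤⟨ ℕ.m≤n+m (k ℕ.+ suc k) (k ℕ.* k) ⟩
  k ℕ.* k ℕ.+ (k ℕ.+ suc k)    ≡⟨ solve 1 (λ k → k :* k :+ (k :+ (con 1 :+ k)) := (con 1 :+ k) :^ 2) refl k ⟩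
  suc k ^ 2                    ∎
  where open ℕ.≤-Reasoning
        open +-*-Solver
        k = ⌊ h /2⌋

-- Here 4L = n + (3n - 4 - 4k), where n covers the 4 and 2n covers 4k ≤ 2h. Adding 4 + 2h to both
-- sides avoids subtraction. The threshold 4 of the theorem comes from this estimate.
n≤4L : ∀ {n h k L} → 4 ≤ n → h ≤ n → k ℕ.+ k ≤ h → n ≡ suc k ℕ.+ L → n ≤ 4 ℕ.* L
n≤4L {n} {h} {k} {L} 4≤n h≤n 2k≤h n≡ = ℕ.+-cancelˡ-≤ (4 ℕ.+ (h ℕ.+ h)) n _ (begin
  4 ℕ.+ (h ℕ.+ h) ℕ.+ n                            ≤⟨ ℕ.+-monoˡ-≤ n (ℕ.+-mono-≤ 4≤n (ℕ.+-mono-≤ h≤n h≤n)) ⟩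
  n ℕ.+ (n ℕ.+ n) ℕ.+ n                            ≡⟨ cong (λ n → n ℕ.+ (n ℕ.+ n) ℕ.+ n) n≡ ⟩
  m ℕ.+ (m ℕ.+ m) ℕ.+ m                            ≡⟨ solve 2 (λ k L → let m = con 1 :+ k :+ L in
                                                        m :+ (m :+ m) :+ m :=
                                                        con 4 :+ ((k :+ k) :+ (k :+ k)) :+ con 4 :* L) refl k L ⟩
  4 ℕ.+ ((k ℕ.+ k) ℕ.+ (k ℕ.+ k)) ℕ.+ 4 ℕ.* L      ≤⟨ ℕ.+-monoˡ-≤ (4 ℕ.* L) (ℕ.+-monoʳ-≤ 4 (ℕ.+-mono-≤ 2k≤h 2k≤h)) ⟩
  4 ℕ.+ (h ℕ.+ h) ℕ.+ 4 ℕ.* L                      ∎)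
  where open ℕ.≤-Reasoning
        open +-*-Solver
        m = suc k ℕ.+ L

^-cancelˡ-≤ : ∀ {m n} → 2 ^ m ≤ 2 ^ n → m ≤ n
^-cancelˡ-≤ {m} {n} 2^m≤2^n = ℕ.≮⇒≥ λ n<m →
  ℕ.<⇒≱ (ℕ.^-monoʳ-< 2 (s≤s (s≤s z≤n)) n<m) 2^m≤2^n

-- The premise on a and b says that a / b ≤ log₂ h.
exponent-bound : ∀ {g h L n t} → 1 ≤ g → h ≤ g ^ 2 → n ≤ 4 ℕ.* L → g ^ L ≤ 2 ^ t →
  ∀ a b → 2 ^ a ≤ h ^ b → a ℕ.* n ≤ t ℕ.* (8 ℕ.* b)
exponent-bound {g} {h} {L} {n} {t} 1≤g h≤g² n≤4L g^L≤2^t a b 2^a≤h^b = ^-cancelˡ-≤ (begin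
  2 ^ (a ℕ.* n)                    ≡⟨ sym (ℕ.^-*-assoc 2 a n) ⟩
  (2 ^ a) ^ n                      ≤⟨ ℕ.^-monoˡ-≤ n 2^a≤h^b ⟩
  (h ^ b) ^ n                      ≤⟨ ℕ.^-monoˡ-≤ n (ℕ.^-monoˡ-≤ b h≤g²) ⟩
  ((g ^ 2) ^ b) ^ n                ≡⟨ trans (ℕ.^-*-assoc (g ^ 2) b n) (ℕ.^-*-assoc g 2 (b ℕ.* n)) ⟩
  g ^ (2 ℕ.* (b ℕ.* n))            ≤⟨ ℕ.^-monoʳ-≤ g (ℕ.*-monoʳ-≤ 2 (ℕ.*-monoʳ-≤ b n≤4L)) ⟩
  g ^ (2 ℕ.* (b ℕ.* (4 ℕ.* L)))    ≡⟨ cong (g ^_) (solve 2 (λ b L → con 2 :* (b :* (con 4 :* L)) := L :* (con 8 :* b)) refl b L) ⟩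
  g ^ (L ℕ.* (8 ℕ.* b))            ≡⟨ sym (ℕ.^-*-assoc g L (8 ℕ.* b)) ⟩
  (g ^ L) ^ (8 ℕ.* b)              ≤⟨ ℕ.^-monoˡ-≤ (8 ℕ.* b) g^L≤2^t ⟩
  (2 ^ t) ^ (8 ℕ.* b)              ≡⟨ ℕ.^-*-assoc 2 t (8 ℕ.* b) ⟩
  2 ^ (t ℕ.* (8 ℕ.* b))            ∎)
  where open ℕ.≤-Reasoning
        open +-*-Solver
        instance _ = ℕ.>-nonZero 1≤g

-- From exponents to rationals and reals

ℕ→ℚ≡natℚ : ∀ n → ℕ→ℚ n ≡ natℚ n
ℕ→ℚ≡natℚ n = ℚ.↥p/↧p≡p (natℚ n)

-- A factor 1/4 comes from `n≤4L` and a factor 1/2 from `h≤[1+⌊h/2⌋]²`.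
c : ℚ
c = + 1 / 8

-- In unnormalised rationals the numerator and denominator of a product compute, so the
-- cross-multiplied inequality can be read off.
clear-denominators : ∀ {t n} s .{{_ : NonNegative s}} → natℚ t < (c * natℚ n) * s →
  t ℕ.* (8 ℕ.* ↧ₙ s) ℕ.< ℤ.∣ ↥ s ∣ ℕ.* n
clear-denominators {t} {n} s@(mkℚ (+ a) b-1 _) t<cns = subst (t ℕ.* (8 ℕ.* ↧ₙ s) ℕ.<_) (ℕ.*-comm n a)
  (ℤ.drop‿+<+ (subst₂ ℤ._<_ left right (ℚᵘ.drop-*<* t<cnsᵘ)))
  where
  t<cnsᵘ : toℚᵘ (natℚ t) ℚᵘ.< (toℚᵘ c ℚᵘ.* toℚᵘ (natℚ n)) ℚᵘ.* toℚᵘ s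
  t<cnsᵘ = ℚᵘ.<-respʳ-≃ (ℚᵘ.≃-trans (ℚ.toℚᵘ-homo-* (c * natℚ n) s)
             (ℚᵘ.*-congʳ {toℚᵘ s} (ℚ.toℚᵘ-homo-* c (natℚ n)))) (ℚ.toℚᵘ-mono-< t<cns)
  left : + t ℤ.* + (8 ℕ.* suc b-1) ≡ + (t ℕ.* (8 ℕ.* suc b-1))
  left = sym (ℤ.pos-* t _)
  right : (+ 1 ℤ.* + n) ℤ.* + a ℤ.* + 1 ≡ + (n ℕ.* a)
  right = trans (ℤ.*-identityʳ _) (trans (cong (ℤ._* + a) (ℤ.*-identityˡ (+ n))) (sym (ℤ.pos-* n a)))

-- Since `≤ᴿ` is a negation, a rational q strictly between t and the product is to be refuted. It
-- supplies p and s = a / b with p < s, 2 ^ a ≤ h ^ b and t < q < c n p ≤ c n s, contradicting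
-- `bound`.
c·n·log₂h≤t : ∀ n h t .{{_ : ℕ.NonZero h}} →
  (∀ a b → 2 ^ a ≤ h ^ b → a ℕ.* n ≤ t ℕ.* (8 ℕ.* b)) →
  (c * ℕ→ℚ n) · log₂ h ≤ᴿ fromℕ t
c·n·log₂h≤t n (suc _) t bound (q , t<q , p , _ , (s , s≥0 , p<s , 2^a≤h^b) , _ , q<cnp , _)
  rewrite ℕ→ℚ≡natℚ n | ℕ→ℚ≡natℚ t =
  ℕ.<⇒≱ (clear-denominators {t} {n} s {{s≥0}}
           (ℚ.<-≤-trans (ℚ.<-trans t<q q<cnp) (ℚ.*-monoˡ-≤-nonNeg (c * natℚ n) {{cn≥0}} (ℚ.<⇒≤ p<s))))
        (bound ℤ.∣ ↥ s ∣ (↧ₙ s) 2^a≤h^b)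
  where
  cn≥0 : NonNegative (c * natℚ n)
  cn≥0 = ℚ.nonNeg*nonNeg⇒nonNeg c (natℚ n)

mainTheorem2 : ∃[ c ] Positive c × ∃[ n₀ ]
    ((n h : ℕ) → n₀ ≤ n → 2 ≤ h → h ≤ n →
    (D : DataStructure) →
    ((T : RootedTree) → nodes T ≤ n → height T ≤ h →
    (W : EdgeValues T) → CorrectOn D T W) →
    ∃[ T ] nodes T ≤ n × height T ≤ h ×
    (∃[ W ] (c * ℕ→ℚ n) · log₂ h ≤ᴿ fromℕ (oracleCalls D T W)))
mainTheorem2 = c , _ , 4 , lower-bound
  where
  lower-bound : ∀ n h → 4 ≤ n → 2 ≤ h → h ≤ n → (D : DataStructure) →
    (∀ T → nodes T ≤ n → height T ≤ h → ∀ W → CorrectOn D T W) →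
    ∃[ T ] nodes T ≤ n × height T ≤ h ×
      (∃[ W ] (c * ℕ→ℚ n) · log₂ h ≤ᴿ fromℕ (oracleCalls D T W))
  lower-bound n h 4≤n 2≤h h≤n D correct =
    let r , g^L≤2^t = broom-lower-bound D (λ r → correct (broom k L) nodes≤n height≤h (weights r))
        t = oracleCalls D (broom k L) (weights r)
    in broom k L , nodes≤n , height≤h , weights r ,
       c·n·log₂h≤t n h t (exponent-bound {L = L} {t = t} (s≤s z≤n) (h≤[1+⌊h/2⌋]² h)
         (n≤4L {k = k} 4≤n h≤n (⌊n/2⌋+⌊n/2⌋≤n h) (sym nodes≡n)) g^L≤2^t)
    where
    instance _ = ℕ.>-nonZero (ℕ.<-trans (s≤s z≤n) 2≤h)
    -- Taking half of h keeps L linear in n even when h = n, while `suc k ^ 2` still reaches h.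
    k = ⌊ h /2⌋
    L = n ∸ suc k
    -- From 2 ≤ h follows 1 ≤ k, hence 1 + k ≤ k + k ≤ h; the bristles add one level below the path.
    1+k≤h : suc k ≤ h
    1+k≤h = ℕ.≤-trans (ℕ.+-monoˡ-≤ k (ℕ.⌊n/2⌋-mono 2≤h)) (⌊n/2⌋+⌊n/2⌋≤n h)
    nodes≡n : suc k ℕ.+ L ≡ n
    nodes≡n = ℕ.m+[n∸m]≡n (ℕ.≤-trans 1+k≤h h≤n)
    nodes≤n : nodes (broom k L) ≤ n
    nodes≤n = ℕ.≤-reflexive nodes≡n
    height≤h : height (broom k L) ≤ h
    height≤h = ℕ.≤-trans (height-broom k L) 1+k≤h
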